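{- Let $s(n)$ denote the minimum number of edges in an $n$-vertex graph that contains every $n$-vertex tree as a subgraph. Then $s(n)\leq \frac{14}{5}n\log_2 n + O(n)$.
   Context: A graph $G$ contains a graph $H$ if some subgraph of $G$ is isomorphic to $H$. -}

module Defs where

open import Data.Bool using (Bool; true; false; if_then_else_; _∧_)
open import Data.Nat using (ℕ; zero; suc; _+_; _<ᵇ_)
open import Data.Fin using (Fin; toℕ) renaming (zero to fzero; suc to fsuc)
open import Data.Fin.Base using (fromℕ; inject₁)
open import Data.List using (List; map; allFin)
open import Data.Nat.ListAction using (sum)
open import Data.Product using (_×_; Σ)
open import Relation.Binary.PropositionalEquality using (_≡_)
open import Function.Definitions using (Injective)

record Graph (n : ℕ) : Set where
  field
    adj    : Fin n → Fin n → Bool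
    sym    : ∀ i j → adj i j ≡ adj j i
    irrefl : ∀ i → adj i i ≡ false
open Graph public

Adj : ∀ {n} → Graph n → Fin n → Fin n → Set
Adj G i j = adj G i j ≡ true

edges : ∀ {n} → Graph n → ℕ
edges {n} G = sum (map (λ i → sum (map (λ j →
  if adj G i j ∧ (toℕ i <ᵇ toℕ j) then 1 else 0) (allFin n))) (allFin n))

data Reach {n} (G : Graph n) : Fin n → Fin n → Set where
  here : ∀ {u} → Reach G u u
  step : ∀ {u w v} → Adj G u w → Reach G w v → Reach G u v

Connected : ∀ {n} → Graph n → Set
Connected {n} G = ∀ (u v : Fin n) → Reach G u v

-- successor index in a cycle of length m (wrapping last to first)
next : ∀ {m} → Fin (suc m) → Fin (suc m)
next {zero} i = i
next {suc m} fzero = fsuc fzero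
next {suc m} (fsuc i) with next {m} i
... | fzero = fzero
... | fsuc j = fsuc (fsuc j)

HasCycle : ∀ {n} → Graph n → Set
HasCycle {n} G = Σ ℕ λ k → Σ (Fin (3 + k) → Fin n) λ f →
  Injective _≡_ _≡_ f × (∀ i → Adj G (f i) (f (next i)))

IsTree : ∀ {n} → Graph n → Set
IsTree G = Connected G × (HasCycle G → Data.Empty.⊥)
  where import Data.Empty

Contains : ∀ {m n} → Graph n → Graph m → Set
Contains {m} {n} G H = Σ (Fin m → Fin n) λ φ →
  Injective _≡_ _≡_ φ × (∀ x y → Adj H x y → Adj G (φ x) (φ y))

Universal : ∀ {n} → Graph n → Set
Universal {n} G = ∀ (T : Graph n) → IsTree T → Contains G T

{-# OPTIONS --safe #-}
-- The host graph has vertices 0, …, n − 1. For every level M = 3M′, M a power of 3, the numbers congruent to M′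
-- modulo M are the slots of that level; a slot is joined to everything within distance 2M + O(1), any other vertex
-- to everything within distance O(1). Each of the log₃ n levels thus contributes 4n + O(n / M + M) edges, and
-- 4 / log₂ 3 < 14 / 5.
-- A tree with fewer than 3M vertices is placed on a run of almost consecutive free numbers: at most two vertices cut
-- it into trees with fewer than M vertices, these vertices take slots of the level in the run, and the small trees
-- take consecutive parts of the remaining numbers, where they are placed recursively. Slots of different levels are
-- distinct and the trees treated at one level occupy disjoint runs, so the slots needed are always free.
module Submission where

open import Defs hiding (sym)
open import Data.Bool using (if_then_else_; true; false; Bool; _∧_; _∨_; T)
open import Data.Bool.Properties using (∨-comm; T-≡; T-∧; T-∨)
open import Data.Empty using (⊥-elim; ⊥)
open import Data.Fin using (Fin; toℕ; fromℕ<) renaming (zero to fzero; suc to fsuc)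
open import Data.Fin.Properties using (toℕ-fromℕ<) renaming (_≟_ to _≟ᶠ_)
open import Data.List using (List; []; _∷_; _++_; length; lookup; allFin; map; upTo; applyUpTo; tabulate)
open import Data.List.Membership.DecPropositional using (_∈?_)
open import Data.List.Membership.Propositional using (_∈_; _∉_)
open import Data.List.Membership.Propositional.Properties using (∈-++⁺ˡ; ∈-++⁺ʳ; ∈-++⁻; ∈-lookup; ∈-allFin; ∈-map⁺; ∈-map⁻; ∈-upTo⁻)
open import Data.List.Membership.Propositional.Properties.WithK using (unique∧set⇒bag)
open import Data.List.Properties using (++-assoc; length-++; ++-identityʳ; map-++; length-upTo; length-tabulate; map-tabulate; map-cong)
open import Data.List.Relation.Binary.BagAndSetEquality using (∼bag⇒↭)
open import Data.List.Relation.Binary.Permutation.Propositional using (_↭_; ↭-refl; ↭-sym; ↭-trans; prep; swap; ↭-reflexive; ↭⇒↭ₛ)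
open import Data.List.Relation.Binary.Permutation.Propositional.Properties using (∈-resp-↭; ↭-length; ++⁺; ++⁺ˡ; ++⁺ʳ; shift; shifts; ++-comm)
import Data.List.Relation.Binary.Permutation.Setoid.Properties as Permutationₛ
open import Data.List.Relation.Unary.All using (All; []; _∷_) renaming (lookup to All-lookup; map to All-map)
open import Data.List.Relation.Unary.All.Properties using (¬Any⇒All¬) renaming (++⁺ to All-++⁺)
open import Data.List.Relation.Unary.AllPairs using ([]; _∷_)
open import Data.List.Relation.Unary.Any using (here; there)
open import Data.List.Relation.Unary.Unique.Propositional using (Unique)
open import Data.List.Relation.Unary.Unique.Propositional.Properties using (allFin⁺; upTo⁺) renaming (++⁺ to Unique-++⁺)
open import Data.Nat using (ℕ; zero; suc; _+_; _*_; _^_; _≤_; _<_; z≤n; s≤s; s≤s⁻¹; _≤?_; _<?_; ∣_-_∣; NonZero; pred; _≤ᵇ_; _<ᵇ_; _⊓_)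
open import Data.Nat.Divisibility using (_∣_; divides; ∣-trans; ∣-refl; ∣⇒≤; ∣m+n∣m⇒∣n; ∣m∣n⇒∣m+n; n∣m*n; _∣0; _∣?_)
open import Data.Nat.ListAction using (sum)
open import Data.Nat.Properties
open import Data.Nat.Tactic.RingSolver using (solve-∀)
open import Data.Product using (Σ; ∃; ∃₂; _×_; _,_; proj₁; proj₂)
import Data.Sum as Sum
open import Data.Sum using (_⊎_; inj₁; inj₂)
open import Data.Unit using (⊤; tt)
open import Function using (_∘_; id; mk⇔; Equivalence)
open import Function.Definitions using (Injective)
open import Relation.Binary.PropositionalEquality using (_≡_; _≢_; refl; sym; trans; cong; subst; subst₂; module ≡-Reasoning; cong₂; setoid)
open import Relation.Nullary using (¬_; yes; no; does)

-- Ordered forests and cutting off subtrees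

-- Ordered forests in left-child/right-sibling form: tree a ts Φ is a tree with
-- root a and child forest ts, followed by the forest Φ.
data Forest (A : Set) : Set where
  ∅    : Forest A
  tree : A → Forest A → Forest A → Forest A

infixr 5 _⊕_
_⊕_ : ∀ {A} → Forest A → Forest A → Forest A
∅           ⊕ Ψ = Ψ
tree a ts Φ ⊕ Ψ = tree a ts (Φ ⊕ Ψ)

elems : ∀ {A} → Forest A → List A
elems ∅             = []
elems (tree a ts Φ) = a ∷ elems ts ++ elems Φ

size : ∀ {A} → Forest A → ℕ
size Φ = length (elems Φ)

data Root {A : Set} (y : A) : Forest A → Set where
  here  : ∀ {ts Φ} → Root y (tree y ts Φ)
  there : ∀ {a ts Φ} → Root y Φ → Root y (tree a ts Φ)

data Edge {A : Set} (x y : A) : Forest A → Set where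
  top   : ∀ {ts Φ} → Root y ts → Edge x y (tree x ts Φ)
  down  : ∀ {a ts Φ} → Edge x y ts → Edge x y (tree a ts Φ)
  right : ∀ {a ts Φ} → Edge x y Φ → Edge x y (tree a ts Φ)

infix 4 _≅_
data _≅_ {A B : Set} : Forest A → Forest B → Set where
  ∅    : ∅ ≅ ∅
  tree : ∀ {a b ts us Φ Ψ} → ts ≅ us → Φ ≅ Ψ → tree a ts Φ ≅ tree b us Ψ

-- Cut Φ c cs Φ′: deleting from Φ the subtree with root c and child forest cs leaves Φ′.
data Cut {A : Set} : Forest A → A → Forest A → Forest A → Set where
  here  : ∀ {c cs Φ} → Cut (tree c cs Φ) c cs Φ
  down  : ∀ {a ts ts′ Φ c cs} → Cut ts c cs ts′ → Cut (tree a ts Φ) c cs (tree a ts′ Φ)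
  right : ∀ {a ts Φ Φ′ c cs} → Cut Φ c cs Φ′ → Cut (tree a ts Φ) c cs (tree a ts Φ′)

Small : ∀ {A} → ℕ → Forest A → Set
Small M ∅             = ⊤
Small M (tree a ts Φ) = suc (size ts) < M × Small M Φ

elems-⊕ : ∀ {A} (Φ Ψ : Forest A) → elems (Φ ⊕ Ψ) ≡ elems Φ ++ elems Ψ
elems-⊕ ∅             Ψ = refl
elems-⊕ (tree a ts Φ) Ψ = cong (a ∷_) (trans (cong (elems ts ++_) (elems-⊕ Φ Ψ)) (sym (++-assoc (elems ts) (elems Φ) (elems Ψ))))

size-⊕ : ∀ {A} (Φ Ψ : Forest A) → size (Φ ⊕ Ψ) ≡ size Φ + size Ψ
size-⊕ Φ Ψ = trans (cong length (elems-⊕ Φ Ψ)) (length-++ (elems Φ))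

size-tree : ∀ {A} (a : A) ts Φ → size (tree a ts Φ) ≡ suc (size ts) + size Φ
size-tree a ts Φ = cong suc (length-++ (elems ts))

Root⇒∈ : ∀ {A} {y : A} {Φ} → Root y Φ → y ∈ elems Φ
Root⇒∈ here = here refl
Root⇒∈ {Φ = tree a ts Φ} (there r) = there (∈-++⁺ʳ (elems ts) (Root⇒∈ r))

Edge⇒∈ : ∀ {A} {x y : A} {Φ} → Edge x y Φ → x ∈ elems Φ × y ∈ elems Φ
Edge⇒∈ (top r) = here refl , there (∈-++⁺ˡ (Root⇒∈ r))
Edge⇒∈ (down e) with Edge⇒∈ e
... | p , q = there (∈-++⁺ˡ p) , there (∈-++⁺ˡ q)
Edge⇒∈ {Φ = tree a ts Φ} (right e) with Edge⇒∈ e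
... | p , q = there (∈-++⁺ʳ (elems ts) p) , there (∈-++⁺ʳ (elems ts) q)

Edge-⊕ˡ : ∀ {A} {x y : A} {Φ Ψ} → Edge x y Φ → Edge x y (Φ ⊕ Ψ)
Edge-⊕ˡ (top r)   = top r
Edge-⊕ˡ (down e)  = down e
Edge-⊕ˡ (right e) = right (Edge-⊕ˡ e)

Edge-⊕ʳ : ∀ {A} {x y : A} Φ {Ψ} → Edge x y Ψ → Edge x y (Φ ⊕ Ψ)
Edge-⊕ʳ ∅             e = e
Edge-⊕ʳ (tree a ts Φ) e = right (Edge-⊕ʳ Φ e)

Small-⊕ : ∀ {A M} (Φ : Forest A) {Ψ} → Small M Φ → Small M Ψ → Small M (Φ ⊕ Ψ)
Small-⊕ ∅             _       q = q
Small-⊕ (tree a ts Φ) (s , p) q = s , Small-⊕ Φ p q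

size<⇒Small : ∀ {A M} (Φ : Forest A) → size Φ < M → Small M Φ
size<⇒Small ∅             _ = tt
size<⇒Small {M = M} (tree a ts Φ) lt =
  ≤-<-trans (m≤m+n _ (size Φ)) lt′ , size<⇒Small Φ (≤-<-trans (m≤n+m _ _) lt′)
  where
  lt′ : suc (size ts) + size Φ < M
  lt′ = subst (_< M) (size-tree a ts Φ) lt

-- The pieces left by a cut are placed together as one forest `Φ ⊕ Φ′`; this takes the result apart
-- again.
≅-⊕ : ∀ {A B : Set} (Φ : Forest A) {Φ′} {Ψ : Forest B} → Φ ⊕ Φ′ ≅ Ψ →
      ∃₂ λ Ψ₁ Ψ₂ → Ψ ≡ Ψ₁ ⊕ Ψ₂ × Φ ≅ Ψ₁ × Φ′ ≅ Ψ₂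
≅-⊕ ∅             s = ∅ , _ , refl , ∅ , s
≅-⊕ (tree a ts Φ) (tree {b = b} {us = us} s t) with ≅-⊕ Φ t
... | Ψ₁ , Ψ₂ , refl , p , q = tree b us Ψ₁ , Ψ₂ , refl , tree s p , q

elems-cut : ∀ {A} {Φ : Forest A} {c cs Φ′} → Cut Φ c cs Φ′ → elems Φ ↭ c ∷ elems cs ++ elems Φ′
elems-cut here = ↭-refl
elems-cut {Φ = tree a ts Φ} {c} {cs} (down {ts′ = ts′} k) = ↭-trans (prep a (++⁺ʳ (elems Φ) (elems-cut k)))
  (subst (λ l → a ∷ c ∷ l ↭ c ∷ elems cs ++ a ∷ elems ts′ ++ elems Φ) (sym (++-assoc (elems cs) _ _))
    (↭-sym (shift a (c ∷ elems cs) (elems ts′ ++ elems Φ))))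
elems-cut {Φ = tree a ts Φ} {c} {cs} (right {Φ′ = Φ′} k) = ↭-trans (++⁺ˡ (a ∷ elems ts) (elems-cut k))
  (shifts (a ∷ elems ts) (c ∷ elems cs))

size-cut : ∀ {A} {Φ : Forest A} {c cs Φ′} → Cut Φ c cs Φ′ → size Φ ≡ suc (size cs) + size Φ′
size-cut {cs = cs} k = trans (↭-length (elems-cut k)) (cong suc (length-++ (elems cs)))

Root-cut : ∀ {A} {Ψ : Forest A} {g ps Ψ′ y} → Cut Ψ g ps Ψ′ → Root y Ψ → y ≡ g ⊎ Root y Ψ′
Root-cut here      here      = inj₁ refl
Root-cut here      (there r) = inj₂ r
Root-cut (down k)  here      = inj₂ here
Root-cut (down k)  (there r) = inj₂ (there r)
Root-cut (right k) here      = inj₂ here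
Root-cut (right k) (there r) with Root-cut k r
... | inj₁ e = inj₁ e
... | inj₂ s = inj₂ (there s)

-- An edge of `Ψ` lies in `Ψ′`, lies in `ps`, leads from `g` to a root of `ps`, or leads from the
-- parent of `g` to `g`. The last two kinds are required for all elements, since a slot will be near
-- every number in question.
Edge-cut : ∀ {A} {R : A → A → Set} {Ψ : Forest A} {g ps Ψ′} → Cut Ψ g ps Ψ′ →
           (∀ {x y} → Edge x y Ψ′ → R x y) → (∀ {x y} → Edge x y ps → R x y) →
           (∀ {y} → y ∈ elems ps → R g y) → (∀ {x} → x ∈ elems Ψ′ → R x g) →
           ∀ {x y} → Edge x y Ψ → R x y
Edge-cut here E′ Eₚ Dₚ D′ (top r)   = Dₚ (Root⇒∈ r)
Edge-cut here E′ Eₚ Dₚ D′ (down e)  = Eₚ e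
Edge-cut here E′ Eₚ Dₚ D′ (right e) = E′ e
Edge-cut (down k) E′ Eₚ Dₚ D′ (top r) with Root-cut k r
... | inj₁ refl = D′ (here refl)
... | inj₂ s    = E′ (top s)
Edge-cut (down k) E′ Eₚ Dₚ D′ (down e)  = Edge-cut k (λ e → E′ (down e)) Eₚ Dₚ (λ i → D′ (there (∈-++⁺ˡ i))) e
Edge-cut (down k) E′ Eₚ Dₚ D′ (right e) = E′ (right e)
Edge-cut (right k) E′ Eₚ Dₚ D′ (top r)   = E′ (top r)
Edge-cut (right k) E′ Eₚ Dₚ D′ (down e)  = E′ (down e)
Edge-cut {Ψ = tree a ts Ψ} (right k) E′ Eₚ Dₚ D′ (right e) =
  Edge-cut k (λ e → E′ (right e)) Eₚ Dₚ (λ i → D′ (there (∈-++⁺ʳ (elems ts) i))) e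

-- The position at which `c` was cut off also makes sense in `Ψ′`, which has the shape of `Φ′`;
-- there `g` and `ps` are inserted.
uncut : ∀ {A B : Set} {Φ : Forest A} {c cs Φ′} (g : B) {ps Ψ′} → Cut Φ c cs Φ′ → cs ≅ ps → Φ′ ≅ Ψ′ →
        ∃ λ Ψ → Φ ≅ Ψ × Cut Ψ g ps Ψ′
uncut g here p q = _ , tree p q , here
uncut g (down k) p (tree q r) with uncut g k p q
... | Ψ , s , l = _ , tree s r , down l
uncut g (right k) p (tree q r) with uncut g k p r
... | Ψ , s , l = _ , tree q s , right l

-- The child forest is searched before its root is tested, so a subtree that is found with at least
-- `M` vertices has only small trees below its root.
heavy-cut : ∀ {A} M (Φ : Forest A) →
            Small M Φ ⊎ (∃ λ c → ∃₂ λ cs Φ′ → Cut Φ c cs Φ′ × Small M cs × M ≤ suc (size cs))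
heavy-cut M ∅ = inj₁ tt
heavy-cut M (tree a ts Φ) with heavy-cut M ts
... | inj₂ (c , cs , _ , k , p) = inj₂ (c , cs , _ , down k , p)
... | inj₁ small with M ≤? suc (size ts)
...   | yes M≤ = inj₂ (a , ts , Φ , here , small , M≤)
...   | no  M≰ with heavy-cut M Φ
...     | inj₂ (c , cs , _ , k , p) = inj₂ (c , cs , _ , right k , p)
...     | inj₁ small′ = inj₁ (≰⇒> M≰ , small′)

-- Runs of almost consecutive numbers

-- Run M a F: F is increasing, and every number from a up to the last entry of F
-- that is missing from F is a multiple of M.
data Run (M : ℕ) : ℕ → List ℕ → Set where
  done : ∀ {a} → Run M a []
  take : ∀ {a F} → Run M (suc a) F → Run M a (a ∷ F)
  skip : ∀ {a F} → M ∣ a → Run M (suc a) F → Run M a F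

Run-weaken : ∀ {M M′ a F} → M′ ∣ M → Run M a F → Run M′ a F
Run-weaken d done       = done
Run-weaken d (take r)   = take (Run-weaken d r)
Run-weaken d (skip e r) = skip (∣-trans d e) (Run-weaken d r)

Run-≤ : ∀ {M a F x} → Run M a F → x ∈ F → a ≤ x
Run-≤ (take r)   (here refl) = ≤-refl
Run-≤ (take r)   (there i)   = <⇒≤ (Run-≤ r i)
Run-≤ (skip _ r) i           = <⇒≤ (Run-≤ r i)

Run-split : ∀ {M a} xs {ys} → Run M a (xs ++ ys) → Run M a xs × ∃ λ b → Run M b ys
Run-split []       r = done , _ , r
Run-split (x ∷ xs) (take r) with Run-split xs r
... | p , q = take p , q
Run-split (x ∷ xs) (skip d r) with Run-split (x ∷ xs) r
... | p , q = skip d p , q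

-- The removed entry turns into a skipped number, which is legitimate for a multiple of `M`.
Run-remove : ∀ {M a F g} → Run M a F → g ∈ F → M ∣ g → ∃ λ F′ → F ↭ g ∷ F′ × Run M a F′
Run-remove (take r) (here refl) d = _ , ↭-refl , skip d r
Run-remove {a = a} {g = g} (take r) (there i) d with Run-remove r i d
... | F′ , p , r′ = a ∷ F′ , ↭-trans (prep a p) (↭-sym (shift a (g ∷ []) F′)) , take r′
Run-remove (skip e r) i d with Run-remove r i d
... | F′ , p , r′ = F′ , p , skip e r′

-- Skips only move the end of a run to the right, so a number below `a + length F` can be missing
-- only by having been skipped.
Run-∈ : ∀ {M a F x} → Run M a F → a ≤ x → x < a + length F → ¬ (M ∣ x) → x ∈ F
Run-∈ {a = a} done a≤x x< _ = ⊥-elim (<-irrefl refl (≤-<-trans a≤x (subst (_ <_) (+-identityʳ a) x<)))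
Run-∈ {a = a} {x = x} (take {F = F} r) a≤x x< ¬d with m≤n⇒m<n∨m≡n a≤x
... | inj₂ refl = here refl
... | inj₁ a<x  = there (Run-∈ r a<x (subst (x <_) (+-suc a (length F)) x<) ¬d)
Run-∈ (skip e r) a≤x x< ¬d with m≤n⇒m<n∨m≡n a≤x
... | inj₂ refl = ⊥-elim (¬d e)
... | inj₁ a<x  = Run-∈ r a<x (m<n⇒m<1+n x<) ¬d

next-multiple : ∀ N a → ∃ λ t → t ≤ N × suc N ∣ a + t
next-multiple N zero = 0 , z≤n , _ ∣0
next-multiple N (suc a) with next-multiple N a
... | zero  , _  , d = N , ≤-refl , subst (suc N ∣_) (trans (+-comm (suc N) _) (trans (cong (_+ suc N) (+-identityʳ a)) (+-suc a N))) (∣m∣n⇒∣m+n ∣-refl d)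
... | suc t , t≤ , d = t , <⇒≤ t≤ , subst (suc N ∣_) (+-suc a t) d

-- The amortised form of "among any suc N consecutive numbers at most one is skipped";
-- t is the distance from a to the next multiple.
Run-span : ∀ {N a F x t} → Run (suc N) a F → x ∈ F → t ≤ N → suc N ∣ a + t →
           N * suc x + t ≤ N * a + suc N * length F + N
Run-span {N} {a} {t = t} (take {F = F} r) (here refl) t≤ d = begin
  N * suc a + t                        ≡⟨ cong (_+ t) (*-suc N a) ⟩
  N + N * a + t                        ≤⟨ +-monoʳ-≤ (N + N * a) t≤ ⟩
  N + N * a + N                        ≡⟨ cong (_+ N) (+-comm N (N * a)) ⟩
  N * a + N + N                        ≤⟨ +-monoˡ-≤ N (+-monoʳ-≤ (N * a) (≤-trans (n≤1+n N) (m≤m*n (suc N) (suc (length F))))) ⟩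
  N * a + suc N * suc (length F) + N   ∎
  where open ≤-Reasoning
Run-span {N} {a} {x = x} {zero} (take {F = F} r) (there i) t≤ d = begin
  N * suc x + 0                             ≡⟨ +-identityʳ _ ⟩
  N * suc x                                 ≤⟨ +-cancelʳ-≤ N _ _ (Run-span r i ≤-refl d′) ⟩
  N * suc a + suc N * length F              ≤⟨ m≤m+n _ (1 + N) ⟩
  N * suc a + suc N * length F + (1 + N)    ≡⟨ eq N a (length F) ⟩
  N * a + suc N * suc (length F) + N        ∎
  where
  open ≤-Reasoning
  d′ : suc N ∣ suc a + N
  d′ = subst (suc N ∣_) (+-suc a N) (∣m∣n⇒∣m+n (subst (suc N ∣_) (+-identityʳ a) d) ∣-refl)
  eq : ∀ N a l → N * suc a + suc N * l + (1 + N) ≡ N * a + suc N * suc l + N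
  eq = solve-∀
Run-span {N} {a} {x = x} {suc t} (take {F = F} r) (there i) t≤ d = begin
  N * suc x + suc t                         ≡⟨ +-suc _ t ⟩
  suc (N * suc x + t)                       ≤⟨ s≤s (Run-span r i (<⇒≤ t≤) (subst (suc N ∣_) (+-suc a t) d)) ⟩
  suc (N * suc a + suc N * length F + N)    ≡⟨ eq N a (length F) ⟩
  N * a + suc N * suc (length F) + N        ∎
  where
  open ≤-Reasoning
  eq : ∀ N a l → suc (N * suc a + suc N * l + N) ≡ N * a + suc N * suc l + N
  eq = solve-∀
Run-span {N} {a} {F} {x} {zero} (skip e r) i t≤ d = begin
  N * suc x + 0                      ≡⟨ +-identityʳ _ ⟩
  N * suc x                          ≤⟨ +-cancelʳ-≤ N _ _ (Run-span r i ≤-refl (subst (suc N ∣_) (+-suc a N) (∣m∣n⇒∣m+n e ∣-refl))) ⟩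
  N * suc a + suc N * length F       ≡⟨ eq N a (length F) ⟩
  N * a + suc N * length F + N       ∎
  where
  open ≤-Reasoning
  eq : ∀ N a l → N * suc a + suc N * l ≡ N * a + suc N * l + N
  eq = solve-∀
Run-span {t = suc t} (skip e r) i t≤ d = ⊥-elim (<⇒≱ (s≤s t≤) (∣⇒≤ (∣m+n∣m⇒∣n d e)))

-- `Run-span` divided by `N`: one skip per `N` entries costs at most `length F / N ≤ k` additional
-- positions.
Run-bound : ∀ {N a F x} k → 1 ≤ N → length F ≤ k * N → Run (suc N) a F → x ∈ F → x ≤ a + length F + k
Run-bound {N} {a} {F} {x} k 1≤N l≤ r i with next-multiple N a
Run-bound {suc N₀} {a} {F} {x} k 1≤N l≤ r i | t , t≤ , d = *-cancelˡ-≤ N (+-cancelʳ-≤ N _ _ (begin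
  N * x + N                          ≡⟨ +-comm (N * x) N ⟩
  N + N * x                          ≡⟨ sym (*-suc N x) ⟩
  N * suc x                          ≤⟨ m≤m+n _ t ⟩
  N * suc x + t                      ≤⟨ Run-span r i t≤ d ⟩
  N * a + suc N * length F + N       ≡⟨ cong (_+ N) (eq N a (length F)) ⟩
  N * a + N * length F + length F + N ≤⟨ +-monoˡ-≤ N (+-monoʳ-≤ (N * a + N * length F) l≤) ⟩
  N * a + N * length F + k * N + N   ≡⟨ cong (_+ N) (eq′ N a (length F) k) ⟩
  N * (a + length F + k) + N         ∎))
  where
  open ≤-Reasoning
  N = suc N₀
  eq : ∀ N a l → N * a + suc N * l ≡ N * a + N * l + l
  eq = solve-∀
  eq′ : ∀ N a l k → N * a + N * l + k * N ≡ N * (a + l + k)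
  eq′ = solve-∀

-- Slots and the distances they reach

-- With `M′ = 3 ^ (1 + i)` and `M = 3 * M′` this is the congruence `x ≡ M′` modulo `M`, written as
-- divisibility of a sum to avoid subtraction.
Slot : ℕ → ℕ → Set
Slot i x = 3 ^ (2 + i) ∣ x + 2 * 3 ^ (1 + i)

-- The contributions of the levels are added, so that the sum over all vertices splits by level. The
-- constant `12` serves the base case and absorbs the skipped numbers of longer runs.
reach : ℕ → ℕ → ℕ
reach zero    x = 12
reach (suc J) x = reach J x + (if does (3 ^ (2 + J) ∣? x + 2 * 3 ^ (1 + J)) then 2 * 3 ^ (2 + J) else 0)

Near : ℕ → ℕ → ℕ → Set
Near J x y = ∣ x - y ∣ ≤ reach J x ⊎ ∣ x - y ∣ ≤ reach J y

12≤reach : ∀ J x → 12 ≤ reach J x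
12≤reach zero    x = ≤-refl
12≤reach (suc J) x = ≤-trans (12≤reach J x) (m≤m+n _ _)

slot-reach : ∀ {i J x} → i < J → Slot i x → 12 + 2 * 3 ^ (2 + i) ≤ reach J x
slot-reach {i} {suc J} {x} i<J d with m≤n⇒m<n∨m≡n (s≤s⁻¹ i<J)
... | inj₁ i<J′ = ≤-trans (slot-reach i<J′ d) (m≤m+n _ _)
... | inj₂ refl with 3 ^ (2 + i) ∣? x + 2 * 3 ^ (1 + i)
...   | yes _ = +-monoˡ-≤ _ (12≤reach i x)
...   | no ¬d = ⊥-elim (¬d d)

∣-∣-bound : ∀ {x y d} → x ≤ y + d → y ≤ x + d → ∣ x - y ∣ ≤ d
∣-∣-bound {x} {y} p q with ≤-total x y
... | inj₁ x≤y = subst (_≤ _) (sym (m≤n⇒∣m-n∣≡n∸m x≤y)) (m≤n+o⇒m∸n≤o y x q)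
... | inj₂ y≤x = subst (_≤ _) (sym (trans (∣-∣-comm x y) (m≤n⇒∣m-n∣≡n∸m y≤x))) (m≤n+o⇒m∸n≤o x y p)

-- The slack of `12` is on the upper side because skips displace entries of a run to the right.
near-slot : ∀ {i J g y} → i < J → Slot i g → g ≤ y + 2 * 3 ^ (2 + i) → y ≤ g + 2 * 3 ^ (2 + i) + 12 →
            Near J g y × Near J y g
near-slot {i} {J} {g} {y} i<J sl p q = inj₁ bound , inj₂ (subst (_≤ reach J g) (∣-∣-comm g y) bound)
  where
  w = 2 * 3 ^ (2 + i)
  bound : ∣ g - y ∣ ≤ reach J g
  bound = ≤-trans (∣-∣-bound (≤-trans p (+-monoʳ-≤ y (m≤n+m w 12)))
                             (≤-trans q (≤-reflexive (trans (+-assoc g w 12) (cong (g +_) (+-comm w 12))))))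
                  (slot-reach i<J sl)

-- Placing forests on runs: small trees and the base case

record Placement {A : Set} (J : ℕ) (Φ : Forest A) (F : List ℕ) : Set where
  field
    forest : Forest ℕ
    shape  : Φ ≅ forest
    perm   : elems forest ↭ F
    near   : ∀ {x y} → Edge x y forest → Near J x y
open Placement

split-length : ∀ {A : Set} m {k} (F : List A) → length F ≡ m + k →
               ∃₂ λ xs ys → F ≡ xs ++ ys × length xs ≡ m × length ys ≡ k
split-length zero    F       e = [] , F , refl , refl , e
split-length (suc m) (x ∷ F) e with split-length m F (suc-injective e)
... | xs , ys , refl , p , q = x ∷ xs , ys , refl , cong suc p , q

relabel : ∀ {A : Set} (Φ : Forest A) (F : List ℕ) → length F ≡ size Φ → ∃ λ Ψ → Φ ≅ Ψ × elems Ψ ≡ F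
relabel ∅             []      e = ∅ , ∅ , refl
relabel (tree a ts Φ) (x ∷ F) e with split-length (size ts) F (trans (suc-injective e) (length-++ (elems ts)))
... | xs , ys , refl , p , q with relabel ts xs p | relabel Φ ys q
... | us , s , refl | Ψ , t , refl = tree x us Ψ , tree s t , refl

-- The statement for the induction on levels. One parameter governs both the size and the gaps: the
-- larger the forest, the sparser the numbers that a run may skip.
Places : Set → ℕ → ℕ → Set
Places A J M = ∀ (Φ : Forest A) {F a} → size Φ < 3 * M → length F ≡ size Φ → Run M a F → Placement J Φ F

-- No edge joins two trees of a forest, so each tree can be placed independently on its own segment
-- of the run.
place-small : ∀ {A J M} → Places A J M → ∀ Φ {F a} → Small (3 * M) Φ → length F ≡ size Φ → Run M a F → Placement J Φ F
place-small rec ∅ {[]} s e r = record { forest = ∅ ; shape = ∅ ; perm = ↭-refl ; near = λ () }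
place-small {M = M} rec (tree c ts Φ) {F} (lt , s) e r
  with split-length (size (tree c ts ∅)) {size Φ} F (trans e (trans (size-tree c ts Φ) (cong (_+ size Φ) (sym size-c))))
  where
  size-c : size (tree c ts ∅) ≡ suc (size ts)
  size-c = trans (size-tree c ts ∅) (+-identityʳ _)
... | xs , ys , refl , p , q with Run-split xs r
... | r₁ , _ , r₂ with rec (tree c ts ∅) (subst (_< 3 * M) (sym (trans (size-tree c ts ∅) (+-identityʳ _))) lt) p r₁ | place-small rec Φ s q r₂
... | P | Q with forest P | shape P | perm P | near P
... | tree x us ∅ | tree s₁ ∅ | p₁ | n₁ = record
  { forest = tree x us (forest Q)
  ; shape  = tree s₁ (shape Q)
  ; perm   = ++⁺ (↭-trans (↭-reflexive (cong (x ∷_) (sym (++-identityʳ _)))) p₁) (perm Q)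
  ; near   = λ { (top r) → n₁ (top r) ; (down e) → n₁ (down e) ; (right e) → near Q e }
  }

place-base : ∀ {A} J → Places A J 3
place-base J Φ {F} {a} lt e r with relabel Φ F e
... | Ψ , s , refl = record
  { forest = Ψ
  ; shape  = s
  ; perm   = ↭-refl
  ; near   = λ {x} {y} ed → let x∈ , y∈ = Edge⇒∈ ed in
             inj₁ (≤-trans (∣-∣-bound (within x∈ y∈) (within y∈ x∈)) (12≤reach J x))
  }
  where
  len : length F ≤ 8
  len = subst (_≤ 8) (sym e) (s≤s⁻¹ lt)
  within : ∀ {x y} → x ∈ elems Ψ → y ∈ elems Ψ → x ≤ y + 12
  within {x} {y} x∈ y∈ = begin
    -- At most 8 entries, and `8 ≤ 4 * 2` where `suc 2` is the modulus: at most four skips, hence a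
    -- spread of `8 + 4 = 12`.
    x                ≤⟨ Run-bound 4 (s≤s z≤n) len r x∈ ⟩
    a + length F + 4 ≡⟨ +-assoc a (length F) 4 ⟩
    a + (length F + 4) ≤⟨ +-mono-≤ (Run-≤ r y∈) (+-monoˡ-≤ 4 len) ⟩
    y + 12           ∎
    where open ≤-Reasoning

-- Finding slots inside a run

next-slot : ∀ i a → ∃ λ g → a ≤ g × g < a + 3 ^ (2 + i) × Slot i g
next-slot i a with next-multiple (pred M) (a + 2 * M′)
  where
  M  = 3 ^ (2 + i)
  M′ = 3 ^ (1 + i)
... | t , t≤ , d = a + t , m≤m+n a t , +-monoʳ-< a (subst (t <_) M≡ (s≤s t≤)) ,
  subst₂ _∣_ M≡ (eq a (2 * 3 ^ (1 + i)) t) d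
  where
  M≡ : suc (pred (3 ^ (2 + i))) ≡ 3 ^ (2 + i)
  M≡ = suc-pred (3 ^ (2 + i)) {{m^n≢0 3 (2 + i)}}
  eq : ∀ a b t → a + b + t ≡ a + t + b
  eq = solve-∀

slot-shift : ∀ i {g} → Slot i g → Slot i (g + 3 ^ (2 + i))
slot-shift i {g} d = subst (3 ^ (2 + i) ∣_) (eq g (3 ^ (2 + i)) (2 * 3 ^ (1 + i))) (∣m∣n⇒∣m+n d ∣-refl)
  where
  eq : ∀ g M b → g + b + M ≡ g + M + b
  eq = solve-∀

-- Otherwise `3 * M′` would divide `2 * M′`, where `M′ = 3 ^ (1 + i)`. Hence a run that skips only
-- multiples of `3 * M′` still has its slots of level `i` free.
slot-not-multiple : ∀ i {g} → Slot i g → ¬ (3 ^ (2 + i) ∣ g)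
slot-not-multiple i d e = <⇒≱ (*-monoˡ-< (3 ^ (1 + i)) (n<1+n 2))
  (∣⇒≤ {{m*n≢0 2 (3 ^ (1 + i))}} (∣m+n∣m⇒∣n d e))
  where
  instance
    nz : NonZero (3 ^ (1 + i))
    nz = m^n≢0 3 (1 + i)

-- This makes an occupied slot an admissible gap for the recursion one level down.
slot-multiple : ∀ i {g} → Slot i g → 3 ^ (1 + i) ∣ g
slot-multiple i {g} d = ∣m+n∣m⇒∣n (subst (3 ^ (1 + i) ∣_) (+-comm g _) (∣-trans (n∣m*n 3) d)) (n∣m*n 2)

3≤3^ : ∀ i → 3 ≤ 3 ^ (1 + i)
3≤3^ i = m≤m*n 3 (3 ^ i) {{m^n≢0 3 i}}

-- The ratio of `3 ^ (1 + i)` to `3 ^ (1 + i)` less one is at most `3 / 2`, so `k ≥ 3 * m / 2` skips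
-- suffice in `Run-bound`.
Run-bound-3^ : ∀ {i a F x} m k → 3 * m ≤ 2 * k → length F ≤ m * 3 ^ (1 + i) →
               Run (3 ^ (1 + i)) a F → x ∈ F → x ≤ a + length F + k
Run-bound-3^ {i} {a} {F} m k m≤ l≤ r x∈ with 3 ^ (1 + i) | 3≤3^ i
... | suc (suc (suc n)) | s≤s (s≤s (s≤s z≤n)) = Run-bound k (s≤s z≤n) (begin
  length F              ≤⟨ l≤ ⟩
  m * suc (2 + n)       ≡⟨ eq m n ⟩
  3 * m + m * n         ≤⟨ +-mono-≤ m≤ (*-monoˡ-≤ n (*-cancelˡ-≤ {m} {k} 3 (≤-trans m≤ (*-monoˡ-≤ k (n≤1+n 2))))) ⟩
  2 * k + k * n         ≡⟨ eq′ k n ⟩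
  k * (2 + n)           ∎) r x∈
  where
  open ≤-Reasoning
  eq : ∀ m n → m * suc (2 + n) ≡ 3 * m + m * n
  eq = solve-∀
  eq′ : ∀ k n → 2 * k + k * n ≡ k * (2 + n)
  eq′ = solve-∀

-- With `M = 3 ^ (2 + i)`, the first slot from `a` on lies below `a + M` and serves for `l < 2 * M`.
-- For longer runs the slot after it is within `2 * M` of both ends.
central-slot : ∀ i a l → 3 ^ (2 + i) ≤ l → l < 3 * 3 ^ (2 + i) →
               ∃ λ g → Slot i g × a ≤ g × g ≤ a + 2 * 3 ^ (2 + i) × g < a + l × a + l ≤ g + 2 * 3 ^ (2 + i)
central-slot i a l M≤l l<3M with next-slot i a
... | g , a≤g , g< , sl with l <? 2 * 3 ^ (2 + i)
...   | yes l<2M = g , sl , a≤g , <⇒≤ (<-≤-trans g< (+-monoʳ-≤ a (m≤m+n _ _))) , <-≤-trans g< (+-monoʳ-≤ a M≤l) ,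
        +-mono-≤ a≤g (<⇒≤ l<2M)
...   | no  l≮2M = g + M , slot-shift i {g} sl , ≤-trans a≤g (m≤m+n g M) , <⇒≤ lt , <-≤-trans lt (+-monoʳ-≤ a (≮⇒≥ l≮2M)) ,
        (begin
          a + l           ≤⟨ +-mono-≤ a≤g (<⇒≤ l<3M) ⟩
          g + 3 * M       ≡⟨ sym (+-assoc g M (2 * M)) ⟩
          g + M + 2 * M   ∎)
  where
  open ≤-Reasoning
  M = 3 ^ (2 + i)
  lt : g + M < a + 2 * M
  lt = begin-strict
    g + M         <⟨ +-monoˡ-< M g< ⟩
    a + M + M     ≡⟨ eq a M ⟩
    a + 2 * M     ∎
    where
    eq : ∀ a M → a + M + M ≡ a + 2 * M
    eq = solve-∀

near-all : ∀ {i J a F g} → i < J → Slot i g → Run (3 ^ (2 + i)) a F → length F < 3 * 3 ^ (2 + i) →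
           g ≤ a + 2 * 3 ^ (2 + i) → a + length F ≤ g + 2 * 3 ^ (2 + i) →
           ∀ {y} → y ∈ F → Near J g y × Near J y g
near-all {i} {a = a} {F} {g} i<J sl r l< p q {y} y∈ = near-slot {i} i<J sl
  (≤-trans p (+-monoˡ-≤ _ (Run-≤ r y∈)))
  (begin
    -- At most five skips, since `3 * 3 ≤ 2 * 5`.
    y                                ≤⟨ Run-bound-3^ {1 + i} 3 5 (n≤1+n 9) (<⇒≤ l<) r y∈ ⟩
    a + length F + 5                 ≤⟨ +-mono-≤ q (m≤m+n 5 7) ⟩
    g + 2 * 3 ^ (2 + i) + 12         ∎)
  where open ≤-Reasoning

-- The inductive step: heavy cuts and their slots

join : ∀ {A J} {Φ : Forest A} {c cs Φ′ g F} → Cut Φ c cs Φ′ →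
       ∀ {ps Ψ′} → cs ≅ ps → Φ′ ≅ Ψ′ → g ∷ elems ps ++ elems Ψ′ ↭ F →
       (∀ {x y} → Edge x y ps → Near J x y) → (∀ {x y} → Edge x y Ψ′ → Near J x y) →
       (∀ {y} → y ∈ elems ps → Near J g y) → (∀ {x} → x ∈ elems Ψ′ → Near J x g) →
       Placement J Φ F
join {J = J} {g = g} k s s′ perm Eₚ E′ Dₚ D′ with uncut g k s s′
... | Ψ , shape , l = record
  { forest = Ψ
  ; shape  = shape
  ; perm   = ↭-trans (elems-cut l) perm
  ; near   = Edge-cut {R = Near J} l E′ Eₚ Dₚ D′
  }

-- The cut vertex `c` takes a central slot. This is near the whole run, so the recursion may place
-- the children and the parent of `c` anywhere in the rest.
place-cut : ∀ {A i J} → i < J →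
            (∀ (Φ : Forest A) {F a} → Small (3 ^ (2 + i)) Φ → length F ≡ size Φ → Run (3 ^ (1 + i)) a F → Placement J Φ F) →
            ∀ {Φ : Forest A} {c cs Φ′ F a} → Cut Φ c cs Φ′ → Small (3 ^ (2 + i)) cs → 3 ^ (2 + i) ≤ suc (size cs) →
            Small (3 ^ (2 + i)) Φ′ → size Φ < 3 * 3 ^ (2 + i) → length F ≡ size Φ → Run (3 ^ (2 + i)) a F → Placement J Φ F
place-cut {i = i} i<J rec {cs = cs} {Φ′} {F} {a} k small M≤ small′ lt len r
  with central-slot i a (length F) (≤-trans M≤ (≤-trans (m≤m+n _ (size Φ′)) (≤-reflexive (sym (trans len (size-cut k)))))) (subst (_< _) (sym len) lt)
... | g , sl , a≤g , g≤ , g< , ≤g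
  with Run-remove (Run-weaken (n∣m*n 3) r) (Run-∈ r a≤g g< (slot-not-multiple i sl)) (slot-multiple i sl)
... | F′ , F↭ , r′
  with rec (cs ⊕ Φ′) (Small-⊕ cs small small′) (trans (suc-injective (trans (sym (↭-length F↭)) (trans len (size-cut k)))) (sym (size-⊕ cs Φ′))) r′
... | P with forest P | ≅-⊕ cs (shape P) | perm P | near P
... | _ | ps , Ψ′ , refl , s , s′ | perm′ | near′ = join k s s′ perm″ (λ e → near′ (Edge-⊕ˡ e)) (λ e → near′ (Edge-⊕ʳ ps e))
        (λ y∈ → proj₁ (close (∈-resp-↭ perm″ (there (∈-++⁺ˡ y∈)))))
        (λ x∈ → proj₂ (close (∈-resp-↭ perm″ (there (∈-++⁺ʳ (elems ps) x∈)))))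
  where
  perm″ : g ∷ elems ps ++ elems Ψ′ ↭ F
  perm″ = ↭-trans (prep g (↭-trans (↭-reflexive (sym (elems-⊕ ps Ψ′))) perm′)) (↭-sym F↭)
  close = near-all i<J sl r (subst (_< _) (sym len) lt) g≤ ≤g

near-prefix : ∀ {i J a F g} → i < J → Slot i g → Run (3 ^ (1 + i)) a F → length F ≤ 2 * 3 ^ (2 + i) →
              a ≤ g → g ≤ a + 3 ^ (2 + i) → ∀ {y} → y ∈ F → Near J g y × Near J y g
near-prefix {i} {a = a} {F} {g} i<J sl r l≤ a≤g g≤ {y} y∈ = near-slot {i} i<J sl
  (≤-trans g≤ (+-mono-≤ (Run-≤ r y∈) (m≤m+n _ _)))
  (begin
    -- With slots removed, the gaps are multiples of `3 ^ (1 + i)` only. The run has at most six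
    -- times that many entries, and `3 * 6 = 2 * 9` allows nine skips.
    y                                ≤⟨ Run-bound-3^ {i} 6 9 ≤-refl (≤-trans l≤ (≤-reflexive (eq (3 ^ (1 + i))))) r y∈ ⟩
    a + length F + 9                 ≤⟨ +-mono-≤ (+-mono-≤ a≤g l≤) (m≤m+n 9 3) ⟩
    g + 2 * 3 ^ (2 + i) + 12         ∎)
  where
  open ≤-Reasoning
  eq : ∀ M → 2 * (3 * M) ≡ 6 * M
  eq = solve-∀

-- `g₂` is controlled from both ends of the run, as it has to be near every entry; `g₁` is
-- controlled from the beginning and serves a prefix.
record Two-slots (i a : ℕ) (F : List ℕ) : Set where
  field
    g₁ g₂ : ℕ
    F₂    : List ℕ
    sl₁   : Slot i g₁
    sl₂   : Slot i g₂
    a≤g₁  : a ≤ g₁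
    g₁≤   : g₁ ≤ a + 3 ^ (2 + i)
    g₂≤   : g₂ ≤ a + 2 * 3 ^ (2 + i)
    ≤g₂   : a + length F ≤ g₂ + 2 * 3 ^ (2 + i)
    F↭    : F ↭ g₁ ∷ g₂ ∷ F₂
    r₂    : Run (3 ^ (1 + i)) a F₂

-- The first two slots from `a` on lie below `a + 2 * 3 ^ (2 + i)`, so a run with that many entries
-- contains both.
two-slots : ∀ {i a F} → Run (3 ^ (2 + i)) a F → 2 * 3 ^ (2 + i) ≤ length F → length F < 3 * 3 ^ (2 + i) → Two-slots i a F
two-slots {i} {a} {F} r 2M≤ lt with next-slot i a
... | g₁ , a≤g₁ , g₁< , sl₁
  with Run-remove (Run-weaken (n∣m*n 3) r)
    (Run-∈ r a≤g₁ (<-≤-trans g₁< (+-monoʳ-≤ a (≤-trans (m≤m+n _ _) 2M≤))) (slot-not-multiple i sl₁)) (slot-multiple i sl₁)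
... | F₁ , F↭₁ , r₁ = result (proj₁ r₂) (proj₁ (proj₂ r₂)) (proj₂ (proj₂ r₂))
  where
  g₂ = g₁ + 3 ^ (2 + i)

  g₂< : g₂ < a + 2 * 3 ^ (2 + i)
  g₂< = <-≤-trans (+-monoˡ-< (3 ^ (2 + i)) g₁<) (≤-reflexive (eq a (3 ^ (2 + i))))
    where
    eq : ∀ a M → a + M + M ≡ a + 2 * M
    eq = solve-∀

  sl₂ : Slot i g₂
  sl₂ = slot-shift i {g₁} sl₁

  g₂∈F₁ : g₂ ∈ F₁
  g₂∈F₁ with ∈-resp-↭ F↭₁
               (Run-∈ r (≤-trans a≤g₁ (m≤m+n g₁ _)) (<-≤-trans g₂< (+-monoʳ-≤ a 2M≤)) (slot-not-multiple i sl₂))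
  ... | there j = j
  ... | here e  = ⊥-elim (<⇒≢ (m<m+n g₁ (m^n>0 3 (2 + i))) (sym e))

  r₂ : ∃ λ F₂ → F₁ ↭ g₂ ∷ F₂ × Run (3 ^ (1 + i)) a F₂
  r₂ = Run-remove r₁ g₂∈F₁ (slot-multiple i sl₂)

  result : ∀ F₂ → F₁ ↭ g₂ ∷ F₂ → Run (3 ^ (1 + i)) a F₂ → Two-slots i a F
  result F₂ F↭₂ r₂ = record
    { g₁ = g₁ ; g₂ = g₂ ; F₂ = F₂ ; sl₁ = sl₁ ; sl₂ = sl₂ ; a≤g₁ = a≤g₁ ; g₁≤ = <⇒≤ g₁< ; g₂≤ = <⇒≤ g₂<
    ; ≤g₂ = ≤-trans (+-mono-≤ a≤g₁ (<⇒≤ lt)) (≤-reflexive (sym (+-assoc g₁ (3 ^ (2 + i)) (2 * 3 ^ (2 + i)))))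
    ; F↭  = ↭-trans F↭₁ (prep g₁ F↭₂)
    ; r₂  = r₂
    }

-- The two cut vertices go to consecutive slots; the pieces incident with the second one fill the beginning of
-- the run, so that they stay within distance 2 * M of the first slot.
place-cut² : ∀ {A i J} → i < J →
             (∀ (Φ : Forest A) {F a} → Small (3 ^ (2 + i)) Φ → length F ≡ size Φ → Run (3 ^ (1 + i)) a F → Placement J Φ F) →
             ∀ {Φ : Forest A} {c cs Φ′ d ds Φ″ F a} → Cut Φ c cs Φ′ → Small (3 ^ (2 + i)) cs → 3 ^ (2 + i) ≤ suc (size cs) →
             Cut Φ′ d ds Φ″ → Small (3 ^ (2 + i)) ds → 3 ^ (2 + i) ≤ suc (size ds) →
             size Φ < 3 * 3 ^ (2 + i) → length F ≡ size Φ → Run (3 ^ (2 + i)) a F → Placement J Φ F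
place-cut² {A} {i} {J} i<J rec {Φ} {c} {cs} {Φ′} {d} {ds} {Φ″} {F} {a} k small M≤ k′ small′ M≤′ lt len r =
  result (two-slots r 2M≤ F<3M)
  where
  sizes : size Φ ≡ suc (size cs) + (suc (size ds) + size Φ″)
  sizes = trans (size-cut k) (cong (suc (size cs) +_) (size-cut k′))

  F<3M : length F < 3 * 3 ^ (2 + i)
  F<3M = subst (_< 3 * 3 ^ (2 + i)) (sym len) lt

  2M≤ : 2 * 3 ^ (2 + i) ≤ length F
  2M≤ = subst (2 * 3 ^ (2 + i) ≤_) (sym (trans len sizes))
    (+-mono-≤ M≤ (≤-trans (≤-reflexive (+-identityʳ (3 ^ (2 + i)))) (≤-trans M≤′ (m≤m+n _ (size Φ″)))))

  Φ′<2M : size Φ′ < 2 * 3 ^ (2 + i)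
  Φ′<2M = +-cancelˡ-< (3 ^ (2 + i)) _ _
    (≤-<-trans (≤-trans (+-monoˡ-≤ (size Φ′) M≤) (≤-reflexive (sym (size-cut k)))) lt)

  -- Two heavy subtrees use up two thirds of the size bound, so what remains consists of small trees
  -- without a further cut.
  Φ″<M : size Φ″ < 3 ^ (2 + i)
  Φ″<M = subst (size Φ″ <_) (+-identityʳ (3 ^ (2 + i))) (+-cancelˡ-< (3 ^ (2 + i)) _ _
    (≤-<-trans (≤-trans (+-monoˡ-≤ (size Φ″) M≤′) (≤-reflexive (sym (size-cut k′)))) Φ′<2M))

  length-rest : ∀ {g₁ g₂ F₂} → F ↭ g₁ ∷ g₂ ∷ F₂ → length F₂ ≡ size (ds ⊕ Φ″) + size cs
  length-rest {F₂ = F₂} F↭ = suc-injective (suc-injective (begin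
    suc (suc (length F₂))                        ≡⟨ sym (↭-length F↭) ⟩
    length F                                     ≡⟨ trans len sizes ⟩
    suc (size cs) + (suc (size ds) + size Φ″)    ≡⟨ eq (size cs) (size ds) (size Φ″) ⟩
    suc (suc (size ds + size Φ″ + size cs))      ≡⟨ cong (λ n → suc (suc (n + size cs))) (sym (size-⊕ ds Φ″)) ⟩
    suc (suc (size (ds ⊕ Φ″) + size cs))         ∎))
    where
    open ≡-Reasoning
    eq : ∀ x y z → suc x + (suc y + z) ≡ suc (suc (y + z + x))
    eq = solve-∀

  result : Two-slots i a F → Placement J Φ F
  result record { g₁ = g₁ ; g₂ = g₂ ; F₂ = F₂ ; sl₁ = sl₁ ; sl₂ = sl₂ ; a≤g₁ = a≤g₁ ; g₁≤ = g₁≤ ; g₂≤ = g₂≤ ; ≤g₂ = ≤g₂ ; F↭ = F↭ ; r₂ = r₂ }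
    with split-length (size (ds ⊕ Φ″)) F₂ (length-rest F↭)
  ... | xs , ys , F₂≡ , |xs| , |ys| with Run-split xs (subst (Run (3 ^ (1 + i)) a) F₂≡ r₂)
  ... | rx , _ , ry with rec (ds ⊕ Φ″) (Small-⊕ ds small′ (size<⇒Small Φ″ Φ″<M)) |xs| rx | rec cs small |ys| ry
  ... | P | Q with forest P | ≅-⊕ ds (shape P) | perm P | near P
  ... | _ | ps , Ψ″ , refl , s , s″ | perm-P | near-P =
    -- The parent of `c` may be `d` or lie in `ds` or `Φ″`, so `c` takes `g₂`, which is near all of
    -- `F`, and `d` takes `g₁`.
    join k (shape Q) (shape U) perm-F (near Q) (near U)
      (λ y∈ → proj₁ (close (∈-resp-↭ perm-F (there (∈-++⁺ˡ y∈)))))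
      (λ x∈ → proj₂ (close (∈-resp-↭ perm-F (there (∈-++⁺ʳ (elems (forest Q)) x∈)))))
    where
    perm-xs : elems ps ++ elems Ψ″ ↭ xs
    perm-xs = ↭-trans (↭-reflexive (sym (elems-⊕ ps Ψ″))) perm-P
    xs≤ : length xs ≤ 2 * 3 ^ (2 + i)
    xs≤ = ≤-trans (≤-reflexive (trans |xs| (size-⊕ ds Φ″)))
      (≤-trans (n≤1+n _) (≤-trans (≤-reflexive (sym (size-cut k′))) (<⇒≤ Φ′<2M)))
    close₁ : ∀ {y} → y ∈ xs → Near J g₁ y × Near J y g₁
    close₁ = near-prefix i<J sl₁ rx xs≤ a≤g₁ g₁≤
    U : Placement J Φ′ (g₁ ∷ xs)
    U = join k′ s s″ (prep g₁ perm-xs) (λ e → near-P (Edge-⊕ˡ e)) (λ e → near-P (Edge-⊕ʳ ps e))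
          (λ y∈ → proj₁ (close₁ (∈-resp-↭ perm-xs (∈-++⁺ˡ y∈))))
          (λ x∈ → proj₂ (close₁ (∈-resp-↭ perm-xs (∈-++⁺ʳ (elems ps) x∈))))
    close : ∀ {y} → y ∈ F → Near J g₂ y × Near J y g₂
    close = near-all i<J sl₂ r F<3M g₂≤ ≤g₂
    perm-F : g₂ ∷ elems (forest Q) ++ elems (forest U) ↭ F
    perm-F = ↭-trans (prep g₂ (↭-trans (++⁺ (perm Q) (perm U)) (++-comm ys (g₁ ∷ xs))))
               (↭-trans (swap g₂ g₁ (↭-reflexive (sym F₂≡))) (↭-sym F↭))

-- Each heavy cut removes at least `3 ^ (2 + i)` of fewer than three times as many vertices, so
-- after none, one or two cuts only small trees remain.
place-step : ∀ {A i J} → i < J → Places A J (3 ^ (1 + i)) → Places A J (3 ^ (2 + i))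
place-step {i = i} i<J rec Φ lt len r with heavy-cut (3 ^ (2 + i)) Φ
... | inj₁ small = place-small rec Φ small len (Run-weaken (n∣m*n 3) r)
... | inj₂ (c , cs , Φ′ , k , small , M≤) with heavy-cut (3 ^ (2 + i)) Φ′
...   | inj₁ small′ = place-cut i<J (place-small rec) k small M≤ small′ lt len r
...   | inj₂ (d , ds , Φ″ , k′ , small′ , M≤′) = place-cut² i<J (place-small rec) k small M≤ k′ small′ M≤′ lt len r

place : ∀ {A J} i → i ≤ J → Places A J (3 ^ (1 + i))
place {J = J} zero    _   = place-base J
place         (suc i) i<J = place-step i<J (place i (<⇒≤ i<J))

-- Paths and cycles in graphs

Unique-resp-↭ : ∀ {A : Set} {xs ys : List A} → xs ↭ ys → Unique xs → Unique ys
Unique-resp-↭ p = Permutationₛ.Unique-resp-↭ (setoid _) (↭⇒↭ₛ p)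

lookup-injective : ∀ {A : Set} {xs : List A} → Unique xs → Injective _≡_ _≡_ (lookup xs)
lookup-injective (_ ∷ _) {fzero}  {fzero}  e = refl
lookup-injective {xs = _ ∷ xs} (p ∷ _) {fzero}  {fsuc j} e = ⊥-elim (All-lookup p (∈-lookup {xs = xs} j) e)
lookup-injective {xs = _ ∷ xs} (p ∷ _) {fsuc i} {fzero}  e = ⊥-elim (All-lookup p (∈-lookup {xs = xs} i) (sym e))
lookup-injective (_ ∷ u) {fsuc i} {fsuc j} e = cong fsuc (lookup-injective u e)

-- A walk from `x` to `y` with its list of vertices; that they are distinct is expressed separately
-- by `Unique`.
data Path {n} (T : Graph n) (y : Fin n) : Fin n → List (Fin n) → Set where
  end  : Path T y y (y ∷ [])
  cons : ∀ {x z ps} → Adj T x z → Path T y z (z ∷ ps) → Path T y x (x ∷ z ∷ ps)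

snoc : ∀ {n} {T : Graph n} {x y z ps} → Path T y x ps → Adj T y z → Path T z x (ps ++ z ∷ [])
snoc end        a = cons a end
snoc (cons b p) a = cons b (snoc p a)

next-last : ∀ {n} {T : Graph n} {x y ps} → Path T y x (x ∷ ps) → ∀ i → next i ≡ fzero → lookup (x ∷ ps) i ≡ y
next-last end        fzero    _ = refl
next-last (cons a p) (fsuc i) e with next i in eq
... | fzero = next-last p i eq

next-step : ∀ {n} {T : Graph n} {x y ps} → Path T y x (x ∷ ps) →
            ∀ i j → next i ≡ fsuc j → Adj T (lookup (x ∷ ps) i) (lookup (x ∷ ps) (fsuc j))
next-step (cons a p) fzero    fzero    _ = a
next-step (cons a p) (fsuc i) j        e with next i in eq
next-step (cons a p) (fsuc i) (fsuc j) refl | fsuc j = next-step p i j eq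

closed-path : ∀ {n} {T : Graph n} {x y ps} → Path T y x (x ∷ ps) → Adj T y x →
              ∀ i → Adj T (lookup (x ∷ ps) i) (lookup (x ∷ ps) (next i))
closed-path {T = T} {x} p a i with next i in eq
... | fzero  = subst (λ u → Adj T u x) (sym (next-last p i eq)) a
... | fsuc j = next-step p i j eq

-- As `u ≢ w`, the path has at least two vertices, and with `v` the closed walk has the three that a
-- cycle requires.
path-cycle : ∀ {n} {T : Graph n} {u v w ps} → Path T w u ps → u ≢ w → Unique (v ∷ ps) → Adj T v u → Adj T w v → HasCycle T
path-cycle end u≢w _ _ _ = ⊥-elim (u≢w refl)
path-cycle {v = v} (cons {x} {z} {ps} a p) _ uniq vu wv =
  length ps , lookup (v ∷ x ∷ z ∷ ps) , lookup-injective uniq , closed-path (cons vu (cons a p)) wv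

Adj-sym : ∀ {n} (T : Graph n) {x y} → Adj T x y → Adj T y x
Adj-sym T {x} {y} a = trans (Graph.sym T y x) a

-- Growing a forest that covers a tree

data Loc {A : Set} (u : A) : Forest A → Set where
  here  : ∀ {ts Φ} → Loc u (tree u ts Φ)
  down  : ∀ {a ts Φ} → Loc u ts → Loc u (tree a ts Φ)
  right : ∀ {a ts Φ} → Loc u Φ → Loc u (tree a ts Φ)

locate : ∀ {A : Set} {u : A} (Φ : Forest A) → u ∈ elems Φ → Loc u Φ
locate (tree a ts Φ) (here refl) = here
locate (tree a ts Φ) (there i) with ∈-++⁻ (elems ts) i
... | inj₁ j = down (locate ts j)
... | inj₂ j = right (locate Φ j)

graft : ∀ {A : Set} {u : A} {Φ} → Loc u Φ → A → Forest A
graft {Φ = tree a ts Φ} here      v = tree a (tree v ∅ ts) Φ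
graft {Φ = tree a ts Φ} (down l)  v = tree a (graft l v) Φ
graft {Φ = tree a ts Φ} (right l) v = tree a ts (graft l v)

elems-graft : ∀ {A : Set} {u : A} {Φ} (l : Loc u Φ) v → elems (graft l v) ↭ v ∷ elems Φ
elems-graft {Φ = tree a ts Φ} here      v = swap a v ↭-refl
elems-graft {Φ = tree a ts Φ} (down l)  v = ↭-trans (prep a (++⁺ʳ (elems Φ) (elems-graft l v))) (swap a v ↭-refl)
elems-graft {Φ = tree a ts Φ} (right l) v = ↭-trans (++⁺ˡ (a ∷ elems ts) (elems-graft l v)) (shift v (a ∷ elems ts) (elems Φ))

Root-graft : ∀ {A : Set} {u y : A} {Φ} (l : Loc u Φ) v → Root y Φ → Root y (graft l v)
Root-graft here      v here      = here
Root-graft here      v (there r) = there r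
Root-graft (down l)  v here      = here
Root-graft (down l)  v (there r) = there r
Root-graft (right l) v here      = here
Root-graft (right l) v (there r) = there (Root-graft l v r)

Edge-graft : ∀ {A : Set} {u x y : A} {Φ} (l : Loc u Φ) v → Edge x y Φ → Edge x y (graft l v)
Edge-graft here      v (top r)   = top (there r)
Edge-graft here      v (down e)  = down (right e)
Edge-graft here      v (right e) = right e
Edge-graft (down l)  v (top r)   = top (Root-graft l v r)
Edge-graft (down l)  v (down e)  = down (Edge-graft l v e)
Edge-graft (down l)  v (right e) = right e
Edge-graft (right l) v (top r)   = top r
Edge-graft (right l) v (down e)  = down e
Edge-graft (right l) v (right e) = right (Edge-graft l v e)

graft-edge : ∀ {A : Set} {u : A} {Φ} (l : Loc u Φ) v → Edge u v (graft l v)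
graft-edge here      v = top here
graft-edge (down l)  v = down (graft-edge l v)
graft-edge (right l) v = right (graft-edge l v)

-- The invariant of the growth. The paths are simple and stay inside the forest, so a vertex outside
-- can close them to a cycle.
record Covers {n} (T : Graph n) (Φ : Forest (Fin n)) : Set where
  field
    unique : Unique (elems Φ)
    cover  : ∀ {x y} → x ∈ elems Φ → y ∈ elems Φ → Adj T x y → Edge x y Φ ⊎ Edge y x Φ
    path   : ∀ {x y} → x ∈ elems Φ → y ∈ elems Φ → ∃ λ ps → Path T y x ps × Unique ps × All (_∈ elems Φ) ps
open Covers

-- A new vertex v has a unique neighbour among the old vertices: a second one would close a cycle through v.
extend : ∀ {n} {T : Graph n} {Φ u v} → (HasCycle T → ⊥) → Covers T Φ → (l : Loc u Φ) → u ∈ elems Φ →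
         v ∉ elems Φ → Adj T u v → Covers T (graft l v)
extend {T = T} {Φ} {u} {v} acyclic C l u∈ v∉ uv = record
  { unique = Unique-resp-↭ (↭-sym grafted) (fresh ∷ unique C)
  ; cover  = λ x∈ y∈ → cover′ (old x∈) (old y∈)
  ; path   = λ x∈ y∈ → let ps , p , uq , all = path′ (old x∈) (old y∈) in ps , p , uq , All-map (∈-resp-↭ (↭-sym grafted)) all
  }
  where
  grafted = elems-graft l v
  fresh : All (v ≢_) (elems Φ)
  fresh = ¬Any⇒All¬ (elems Φ) v∉
  old : ∀ {x} → x ∈ elems (graft l v) → x ∈ v ∷ elems Φ
  old = ∈-resp-↭ grafted

  fresh-in : ∀ {ps} → All (_∈ elems Φ) ps → All (v ≢_) ps
  fresh-in = All-map (All-lookup fresh)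

  only : ∀ {w} → w ∈ elems Φ → Adj T w v → u ≡ w
  only {w} w∈ wv with u ≟ᶠ w
  ... | yes e   = e
  ... | no  u≢w with path C u∈ w∈
  ...   | ps , p , uq , all = ⊥-elim (acyclic (path-cycle p u≢w (fresh-in all ∷ uq) (Adj-sym T uv) wv))

  cover′ : ∀ {x y} → x ∈ v ∷ elems Φ → y ∈ v ∷ elems Φ → Adj T x y → Edge x y (graft l v) ⊎ Edge y x (graft l v)
  cover′ (here refl) (here refl) a with trans (sym a) (irrefl T v)
  ... | ()
  cover′ (here refl) (there y∈) a with only y∈ (Adj-sym T a)
  ... | refl = inj₂ (graft-edge l v)
  cover′ (there x∈) (here refl) a with only x∈ a
  ... | refl = inj₁ (graft-edge l v)
  cover′ (there x∈) (there y∈) a with cover C x∈ y∈ a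
  ... | inj₁ e = inj₁ (Edge-graft l v e)
  ... | inj₂ e = inj₂ (Edge-graft l v e)

  path′ : ∀ {x y} → x ∈ v ∷ elems Φ → y ∈ v ∷ elems Φ → ∃ λ ps → Path T y x ps × Unique ps × All (_∈ v ∷ elems Φ) ps
  path′ (here refl) (here refl) = _ , end , [] ∷ [] , here refl ∷ []
  -- Matching on the path reveals that its list begins with `u`, the form that `cons` demands.
  path′ (here refl) (there y∈) with path C u∈ y∈
  ... | _ , end , uq , all = _ , cons (Adj-sym T uv) end , fresh-in all ∷ uq , here refl ∷ All-map there all
  ... | _ , cons a p , uq , all = _ , cons (Adj-sym T uv) (cons a p) , fresh-in all ∷ uq , here refl ∷ All-map there all
  path′ (there x∈) (here refl) with path C x∈ u∈
  ... | ps , p , uq , all = _ , snoc p uv ,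
    Unique-++⁺ uq ([] ∷ []) (λ { (v∈ , here refl) → v∉ (All-lookup all v∈) }) , All-++⁺ (All-map there all) (here refl ∷ [])
  path′ (there x∈) (there y∈) with path C x∈ y∈
  ... | ps , p , uq , all = ps , p , uq , All-map there all

infix 4 _⊑_
_⊑_ : ∀ {A : Set} → Forest A → Forest A → Set
Φ ⊑ Ψ = ∀ {x} → x ∈ elems Φ → x ∈ elems Ψ

-- Follow the walk from `u`: a vertex outside the forest is grafted as a child of its predecessor,
-- which already belongs to it.
absorb : ∀ {n} {T : Graph n} {Φ u v} → (HasCycle T → ⊥) → Covers T Φ → u ∈ elems Φ → Reach T u v →
         ∃ λ Ψ → Covers T Ψ × Φ ⊑ Ψ × v ∈ elems Ψ
absorb acyclic C u∈ here = _ , C , (λ x∈ → x∈) , u∈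
absorb {Φ = Φ} acyclic C u∈ (step {w = w} a r) with _∈?_ _≟ᶠ_ w (elems Φ)
... | yes w∈ = absorb acyclic C w∈ r
... | no  w∉ with locate Φ u∈
...   | l with absorb acyclic (extend acyclic C l u∈ w∉ a) (∈-resp-↭ (↭-sym (elems-graft l w)) (here refl)) r
...     | Ψ , D , sub , v∈ = Ψ , D , (λ x∈ → sub (∈-resp-↭ (↭-sym (elems-graft l w)) (there x∈))) , v∈

absorb-all : ∀ {n} {T : Graph n} {Φ u} → IsTree T → Covers T Φ → u ∈ elems Φ → (vs : List (Fin n)) →
             ∃ λ Ψ → Covers T Ψ × Φ ⊑ Ψ × (∀ {v} → v ∈ vs → v ∈ elems Ψ)
absorb-all tr C u∈ [] = _ , C , (λ x∈ → x∈) , λ ()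
absorb-all {u = u} tr@(conn , acyclic) C u∈ (v ∷ vs) with absorb acyclic C u∈ (conn u v)
... | Ψ , D , sub , v∈ with absorb-all tr D (sub u∈) vs
...   | Ω , E , sub′ , all = Ω , E , (λ x∈ → sub′ (sub x∈)) , λ { (here refl) → sub′ v∈ ; (there i) → all i }

spanning-forest : ∀ {n} {T : Graph (suc n)} → IsTree T → ∃ λ Φ → Covers T Φ × (∀ v → v ∈ elems Φ)
spanning-forest {n} {T} tr with absorb-all tr single (here refl) (allFin (suc n))
  where
  single : Covers T (tree fzero ∅ ∅)
  single = record
    { unique = [] ∷ []
    ; cover  = λ { (here refl) (here refl) a → ⊥-elim (loop a) }
    ; path   = λ { (here refl) (here refl) → _ , end , [] ∷ [] , here refl ∷ [] }
    }
    where
    loop : Adj T fzero fzero → ⊥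
    loop a with trans (sym a) (irrefl T fzero)
    ... | ()
... | Φ , C , _ , all = Φ , C , λ v → all (∈-allFin v)

-- The host graph and its universality

linked : ℕ → ℕ → ℕ → Bool
linked J x y = (0 <ᵇ ∣ x - y ∣) ∧ ((∣ x - y ∣ ≤ᵇ reach J x) ∨ (∣ x - y ∣ ≤ᵇ reach J y))

linked-sym : ∀ J x y → linked J x y ≡ linked J y x
linked-sym J x y rewrite ∣-∣-comm x y = cong ((0 <ᵇ ∣ y - x ∣) ∧_) (∨-comm (∣ y - x ∣ ≤ᵇ reach J x) _)

linked-irrefl : ∀ J x → linked J x x ≡ false
linked-irrefl J x rewrite ∣n-n∣≡0 x = refl

near⇒linked : ∀ {J x y} → x ≢ y → Near J x y → linked J x y ≡ true
near⇒linked {J} {x} {y} x≢y near = Equivalence.to T-≡ (Equivalence.from T-∧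
  (<⇒<ᵇ (n≢0⇒n>0 (λ e → x≢y (∣m-n∣≡0⇒m≡n e))) ,
   Equivalence.from T-∨ (Sum.map ≤⇒≤ᵇ ≤⇒≤ᵇ near)))

host : ∀ n → ℕ → Graph n
host n J = record
  { adj    = λ i j → linked J (toℕ i) (toℕ j)
  ; sym    = λ i j → linked-sym J (toℕ i) (toℕ j)
  ; irrefl = λ i → linked-irrefl J (toℕ i)
  }

-- The correspondence of labels as a list of pairs. When neither forest repeats a label, it is the
-- graph of a bijection.
labels : ∀ {A B : Set} {Φ : Forest A} {Ψ : Forest B} → Φ ≅ Ψ → List (A × B)
labels ∅ = []
labels (tree {a} {b} s t) = (a , b) ∷ labels s ++ labels t

map-labels₁ : ∀ {A B : Set} {Φ : Forest A} {Ψ : Forest B} (s : Φ ≅ Ψ) → map proj₁ (labels s) ≡ elems Φ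
map-labels₁ ∅ = refl
map-labels₁ (tree {a} s t) = cong (a ∷_) (trans (map-++ proj₁ (labels s) (labels t)) (cong₂ _++_ (map-labels₁ s) (map-labels₁ t)))

map-labels₂ : ∀ {A B : Set} {Φ : Forest A} {Ψ : Forest B} (s : Φ ≅ Ψ) → map proj₂ (labels s) ≡ elems Ψ
map-labels₂ ∅ = refl
map-labels₂ (tree {b = b} s t) = cong (b ∷_) (trans (map-++ proj₂ (labels s) (labels t)) (cong₂ _++_ (map-labels₂ s) (map-labels₂ t)))

Root-≅ : ∀ {A B : Set} {Φ : Forest A} {Ψ : Forest B} {y} (s : Φ ≅ Ψ) → Root y Φ → ∃ λ q → (y , q) ∈ labels s × Root q Ψ
Root-≅ (tree s t) here = _ , here refl , here
Root-≅ (tree s t) (there r) with Root-≅ t r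
... | q , q∈ , r′ = q , there (∈-++⁺ʳ (labels s) q∈) , there r′

Edge-≅ : ∀ {A B : Set} {Φ : Forest A} {Ψ : Forest B} {x y} (s : Φ ≅ Ψ) → Edge x y Φ →
         ∃₂ λ p q → (x , p) ∈ labels s × (y , q) ∈ labels s × Edge p q Ψ
Edge-≅ (tree s t) (top r) with Root-≅ s r
... | q , q∈ , r′ = _ , q , here refl , there (∈-++⁺ˡ q∈) , top r′
Edge-≅ (tree s t) (down e) with Edge-≅ s e
... | p , q , p∈ , q∈ , e′ = p , q , there (∈-++⁺ˡ p∈) , there (∈-++⁺ˡ q∈) , down e′
Edge-≅ (tree s t) (right e) with Edge-≅ t e
... | p , q , p∈ , q∈ , e′ = p , q , there (∈-++⁺ʳ (labels s) p∈) , there (∈-++⁺ʳ (labels s) q∈) , right e′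

unique-key : ∀ {A B : Set} (f : A → B) {xs x y} → Unique (map f xs) → x ∈ xs → y ∈ xs → f x ≡ f y → x ≡ y
unique-key f (_ ∷ _) (here refl) (here refl) _ = refl
unique-key f (p ∷ _) (here refl) (there y∈)  e = ⊥-elim (All-lookup p (∈-map⁺ f y∈) e)
unique-key f (p ∷ _) (there x∈)  (here refl) e = ⊥-elim (All-lookup p (∈-map⁺ f x∈) (sym e))
unique-key f (_ ∷ u) (there x∈)  (there y∈)  e = unique-key f u x∈ y∈ e

Run-upTo : ∀ {M} a n {f} → (∀ i → f i ≡ a + i) → Run M a (applyUpTo f n)
Run-upTo a zero    eq = done
Run-upTo {M} a (suc n) {f} eq = subst (λ x → Run M a (x ∷ applyUpTo (f ∘ suc) n)) (sym (trans (eq 0) (+-identityʳ a)))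
  (take (Run-upTo (suc a) n (λ i → trans (eq (suc i)) (+-suc a i))))

-- A vertex is sent to its partner in `labels`. Each edge of `T` occurs in `Φ` in one orientation,
-- and symmetry of the host supplies the other.
placement⇒contains : ∀ {n J} {T : Graph n} {Φ} → Covers T Φ → (∀ v → v ∈ elems Φ) → Placement J Φ (upTo n) → Contains (host n J) T
placement⇒contains {n} {J} {T} {Φ} C all P = φ , φ-injective , φ-adj
  where
  L = labels (shape P)
  unique₁ : Unique (map proj₁ L)
  unique₁ = subst Unique (sym (map-labels₁ (shape P))) (unique C)
  unique₂ : Unique (map proj₂ L)
  unique₂ = subst Unique (sym (map-labels₂ (shape P))) (Unique-resp-↭ (↭-sym (perm P)) (upTo⁺ n))

  at : ∀ v → ∃ λ x → (v , x) ∈ L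
  at v with ∈-map⁻ proj₁ (subst (v ∈_) (sym (map-labels₁ (shape P))) (all v))
  ... | (_ , x) , i , refl = x , i

  at<n : ∀ v → proj₁ (at v) < n
  at<n v = ∈-upTo⁻ (∈-resp-↭ (perm P) (subst (proj₁ (at v) ∈_) (map-labels₂ (shape P)) (∈-map⁺ proj₂ (proj₂ (at v)))))

  φ : Fin n → Fin n
  φ v = fromℕ< (at<n v)

  toℕ-φ : ∀ {v x} → (v , x) ∈ L → toℕ (φ v) ≡ x
  toℕ-φ {v} i = trans (toℕ-fromℕ< (at<n v)) (cong proj₂ (unique-key proj₁ unique₁ (proj₂ (at v)) i refl))

  φ-injective : ∀ {v w} → φ v ≡ φ w → v ≡ w
  φ-injective {v} {w} e = cong proj₁ (unique-key proj₂ unique₂ (proj₂ (at v)) (proj₂ (at w))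
    (trans (sym (toℕ-fromℕ< (at<n v))) (trans (cong toℕ e) (toℕ-fromℕ< (at<n w)))))

  φ-edge : ∀ {x y} → Adj T x y → Edge x y Φ → Adj (host n J) (φ x) (φ y)
  φ-edge {x} {y} a e with Edge-≅ (shape P) e
  ... | p , q , p∈ , q∈ , e′ = subst₂ (λ a b → linked J a b ≡ true) (sym (toℕ-φ p∈)) (sym (toℕ-φ q∈))
      (near⇒linked {J} p≢q (near P e′))
    where
    x≢y : x ≢ y
    x≢y refl with trans (sym a) (irrefl T x)
    ... | ()
    p≢q : p ≢ q
    p≢q refl = x≢y (cong proj₁ (unique-key proj₂ unique₂ p∈ q∈ refl))

  φ-adj : ∀ x y → Adj T x y → Adj (host n J) (φ x) (φ y)
  φ-adj x y a with cover C (all x) (all y) a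
  ... | inj₁ e = φ-edge a e
  ... | inj₂ e = Adj-sym (host n J) {φ y} {φ x} (φ-edge (Adj-sym T a) e)

host-universal : ∀ {n J} → n < 3 ^ (2 + J) → Universal (host n J)
host-universal {zero}  _  T _  = (λ ()) , (λ {}) , λ ()
host-universal {suc n} {J} n< T tr with spanning-forest tr
... | Φ , C , all = placement⇒contains C all
    -- The numbers below `suc n` form a run without gaps, hence a run for every modulus; the top
    -- level applies because `3 * 3 ^ (1 + J)` is `3 ^ (2 + J)`.
    (place J ≤-refl Φ (subst (_< 3 ^ (2 + J)) (sym size≡) n<) (trans (length-upTo (suc n)) (sym size≡)) (Run-upTo 0 (suc n) λ _ → refl))
  where
  size≡ : size Φ ≡ suc n
  -- A list without repetitions that contains every vertex is a permutation of `allFin`.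
  size≡ = trans (↭-length (∼bag⇒↭ (unique∧set⇒bag (unique C) (allFin⁺ (suc n)) (mk⇔ (λ _ → ∈-allFin _) (λ _ → all _)))))
    (length-tabulate id)

-- Counting the edges of the host graph

Σ< : ℕ → (ℕ → ℕ) → ℕ
Σ< zero    f = 0
Σ< (suc n) f = f 0 + Σ< n (f ∘ suc)

sum-tabulate : ∀ n f → sum (tabulate {n = n} (f ∘ toℕ)) ≡ Σ< n f
sum-tabulate zero    f = refl
sum-tabulate (suc n) f = cong (f 0 +_) (sum-tabulate n (f ∘ suc))

sum-allFin : ∀ n f → sum (map (f ∘ toℕ) (allFin n)) ≡ Σ< n f
sum-allFin n f = trans (cong sum (map-tabulate {n = n} id (f ∘ toℕ))) (sum-tabulate n f)

Σ<-mono : ∀ n {f g} → (∀ x → f x ≤ g x) → Σ< n f ≤ Σ< n g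
Σ<-mono zero    _ = z≤n
Σ<-mono (suc n) p = +-mono-≤ (p 0) (Σ<-mono n (p ∘ suc))

Σ<-cong : ∀ n {f g} → (∀ x → f x ≡ g x) → Σ< n f ≡ Σ< n g
Σ<-cong zero    _ = refl
Σ<-cong (suc n) p = cong₂ _+_ (p 0) (Σ<-cong n (p ∘ suc))

Σ<-+ : ∀ n f g → Σ< n (λ x → f x + g x) ≡ Σ< n f + Σ< n g
Σ<-+ zero    f g = refl
Σ<-+ (suc n) f g = trans (cong (f 0 + g 0 +_) (Σ<-+ n (f ∘ suc) (g ∘ suc))) (eq (f 0) (g 0) (Σ< n (f ∘ suc)) (Σ< n (g ∘ suc)))
  where
  eq : ∀ a b c d → a + b + (c + d) ≡ a + c + (b + d)
  eq = solve-∀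

Σ<-0 : ∀ n → Σ< n (λ _ → 0) ≡ 0
Σ<-0 zero    = refl
Σ<-0 (suc n) = Σ<-0 n

Σ<-const : ∀ n c → Σ< n (λ _ → c) ≡ n * c
Σ<-const zero    c = refl
Σ<-const (suc n) c = cong (c +_) (Σ<-const n c)

Σ<-* : ∀ n f c → Σ< n (λ x → f x * c) ≡ Σ< n f * c
Σ<-* zero    f c = refl
Σ<-* (suc n) f c = trans (cong (f 0 * c +_) (Σ<-* n (f ∘ suc) c)) (sym (*-distribʳ-+ c (f 0) (Σ< n (f ∘ suc))))

Σ<-swap : ∀ m n (f : ℕ → ℕ → ℕ) → Σ< m (λ x → Σ< n (f x)) ≡ Σ< n (λ y → Σ< m (λ x → f x y))
Σ<-swap zero    n f = sym (Σ<-0 n)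
Σ<-swap (suc m) n f = trans (cong (Σ< n (f 0) +_) (Σ<-swap m n (f ∘ suc))) (sym (Σ<-+ n (f 0) _))

⟦_⟧ : Bool → ℕ
⟦ b ⟧ = if b then 1 else 0

ahead : ℕ → ℕ → ℕ → ℕ
ahead r x y = ⟦ (x <ᵇ y) ∧ (∣ x - y ∣ ≤ᵇ r) ⟧

count-below : ∀ n r → Σ< n (λ y → ⟦ y <ᵇ r ⟧) ≤ r
count-below zero    r       = z≤n
count-below (suc n) zero    = ≤-reflexive (Σ<-0 n)
count-below (suc n) (suc r) = s≤s (count-below n r)

count-ahead : ∀ n r x → Σ< n (ahead r x) ≤ r
count-ahead zero    r x       = z≤n
count-ahead (suc n) r zero    = count-below n r
count-ahead (suc n) r (suc x) = count-ahead n r x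

-- The bound `r` alone would not survive the induction: counting `x = 0` adds one while `r` stays
-- the same. The minimum with `y` decreases together with `y`.
count-behind : ∀ n r y → Σ< n (λ x → ahead r x y) ≤ y ⊓ r
count-behind zero    r y       = z≤n
count-behind (suc n) r zero    = ≤-reflexive (Σ<-0 n)
count-behind (suc n) zero (suc y) = ≤-trans (count-behind n zero y) (≤-reflexive (⊓-zeroʳ y))
count-behind (suc n) (suc r) (suc y) with y <ᵇ suc r in eq
... | true  = s≤s (≤-trans (count-behind n (suc r) y) (≤-reflexive (trans (m≤n⇒m⊓n≡m (m≤n⇒m≤1+n y≤r)) (sym (m≤n⇒m⊓n≡m y≤r)))))
  where
  y≤r : y ≤ r
  y≤r = s≤s⁻¹ (<ᵇ⇒< y (suc r) (Equivalence.from T-≡ eq))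
... | false = ≤-trans (count-behind n (suc r) y) (⊓-monoˡ-≤ (suc r) (n≤1+n y))

-- Each edge is charged to an end whose reach covers it. A vertex receives at most its reach in
-- charges from larger neighbours, and at most as many from smaller ones.
edges-host : ∀ n J → edges (host n J) ≤ 2 * Σ< n (reach J)
edges-host n J = begin
  edges (host n J)
    ≡⟨ trans (cong sum (map-cong (λ i → sum-allFin n (h (toℕ i))) (allFin n))) (sum-allFin n (λ x → Σ< n (h x))) ⟩
  Σ< n (λ x → Σ< n (h x))
    ≤⟨ Σ<-mono n (λ x → Σ<-mono n (split x)) ⟩
  Σ< n (λ x → Σ< n (λ y → ahead (reach J x) x y + ahead (reach J y) x y))
    ≡⟨ trans (Σ<-cong n (λ x → Σ<-+ n (ahead (reach J x) x) (λ y → ahead (reach J y) x y)))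
             (Σ<-+ n (λ x → Σ< n (ahead (reach J x) x)) (λ x → Σ< n (λ y → ahead (reach J y) x y))) ⟩
  Σ< n (λ x → Σ< n (ahead (reach J x) x)) + Σ< n (λ x → Σ< n (λ y → ahead (reach J y) x y))
    ≡⟨ cong (Σ< n (λ x → Σ< n (ahead (reach J x) x)) +_) (Σ<-swap n n (λ x y → ahead (reach J y) x y)) ⟩
  Σ< n (λ x → Σ< n (ahead (reach J x) x)) + Σ< n (λ y → Σ< n (λ x → ahead (reach J y) x y))
    ≤⟨ +-mono-≤ (Σ<-mono n (λ x → count-ahead n (reach J x) x))
                (Σ<-mono n (λ y → ≤-trans (count-behind n (reach J y) y) (m⊓n≤n y (reach J y)))) ⟩
  Σ< n (reach J) + Σ< n (reach J)
    ≡⟨ cong (Σ< n (reach J) +_) (sym (+-identityʳ _)) ⟩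
  2 * Σ< n (reach J) ∎
  where
  open ≤-Reasoning
  h : ℕ → ℕ → ℕ
  h x y = if linked J x y ∧ (x <ᵇ y) then 1 else 0
  cases : ∀ a p q r → (if (a ∧ (p ∨ q)) ∧ r then 1 else 0) ≤ ⟦ r ∧ p ⟧ + ⟦ r ∧ q ⟧
  cases false p     q     r     = z≤n
  cases true  true  q     false = z≤n
  cases true  true  q     true  = s≤s z≤n
  cases true  false false r     = z≤n
  cases true  false true  false = z≤n
  cases true  false true  true  = s≤s z≤n
  split : ∀ x y → h x y ≤ ahead (reach J x) x y + ahead (reach J y) x y
  split x y = cases (0 <ᵇ ∣ x - y ∣) (∣ x - y ∣ ≤ᵇ reach J x) (∣ x - y ∣ ≤ᵇ reach J y) (x <ᵇ y)

-- q counts positive multiples of m that are less than t.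
count-multiples : ∀ m n (g : ℕ → Bool) t q → (∀ x → T (g x) → m ∣ x + t) → q * m < t →
                  (q + Σ< n (⟦_⟧ ∘ g)) * m < n + t
count-multiples m zero    g t q hit lt = subst (λ k → k * m < t) (sym (+-identityʳ q)) lt
count-multiples m (suc n) g t q hit lt with g 0 in eq
... | false = subst ((q + Σ< n (⟦_⟧ ∘ g ∘ suc)) * m <_) (+-suc n t)
    (count-multiples m n (g ∘ suc) (suc t) q (λ x h → subst (m ∣_) (sym (+-suc x t)) (hit (suc x) h)) (m<n⇒m<1+n lt))
... | true  = subst₂ _<_ (cong (_* m) (sym (+-suc q _))) (+-suc n t)
    (count-multiples m n (g ∘ suc) (suc t) (suc q) (λ x h → subst (m ∣_) (sym (+-suc x t)) (hit (suc x) h)) (s≤s next≤))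
  where
  -- The hit at `0` makes `t` a multiple of `m`; being larger than `q * m`, it is at least the next
  -- multiple.
  next≤ : suc q * m ≤ t
  next≤ with hit 0 (Equivalence.from T-≡ eq)
  ... | divides k t≡ = ≤-trans (*-monoˡ-≤ m (*-cancelʳ-< m q k (subst (q * m <_) t≡ lt))) (≤-reflexive (sym t≡))

-- A level has about `n / M` slots, each reaching `2 * M` further, and so adds `2 * n` up to an
-- error of order `M`. These errors grow geometrically and are gathered in the last power of three.
reach-sum : ∀ n J → Σ< n (reach J) ≤ 12 * n + 2 * (J * n) + 3 ^ (2 + J)
reach-sum n zero = ≤-trans (≤-reflexive (trans (Σ<-const n 12) (trans (*-comm n 12) (sym (+-identityʳ _))))) (m≤m+n _ 9)
reach-sum n (suc J) = begin
  Σ< n (reach (suc J))                                  ≡⟨ Σ<-+ n (reach J) _ ⟩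
  Σ< n (reach J) + Σ< n (λ x → if hit x then w else 0)  ≡⟨ cong (Σ< n (reach J) +_) (trans (Σ<-cong n weight) (Σ<-* n (⟦_⟧ ∘ hit) w)) ⟩
  Σ< n (reach J) + c * w                                ≤⟨ +-mono-≤ (reach-sum n J) slots ⟩
  -- Padding that completes the error to a power of three: in units of `3 ^ (1 + J)`,
  -- `3 + 4 + 2 = 9`.
  12 * n + 2 * (J * n) + 3 ^ (2 + J) + 2 * (n + 2 * 3 ^ (1 + J)) ≤⟨ m≤m+n _ (2 * 3 ^ (1 + J)) ⟩
  12 * n + 2 * (J * n) + 3 ^ (2 + J) + 2 * (n + 2 * 3 ^ (1 + J)) + 2 * 3 ^ (1 + J) ≡⟨ eq n (J * n) (3 ^ (1 + J)) ⟩
  12 * n + 2 * (n + J * n) + 3 ^ (3 + J)                ∎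
  where
  open ≤-Reasoning
  w = 2 * 3 ^ (2 + J)
  hit : ℕ → Bool
  hit x = does (3 ^ (2 + J) ∣? x + 2 * 3 ^ (1 + J))
  c = Σ< n (⟦_⟧ ∘ hit)
  weight : ∀ x → (if hit x then w else 0) ≡ ⟦ hit x ⟧ * w
  weight x with hit x
  ... | true  = sym (+-identityʳ w)
  ... | false = refl
  sound : ∀ x → T (hit x) → 3 ^ (2 + J) ∣ x + 2 * 3 ^ (1 + J)
  sound x h with 3 ^ (2 + J) ∣? x + 2 * 3 ^ (1 + J)
  ... | yes d = d
  slots : c * w ≤ 2 * (n + 2 * 3 ^ (1 + J))
  slots = begin
    c * w                          ≡⟨ trans (sym (*-assoc c 2 _)) (trans (cong (_* 3 ^ (2 + J)) (*-comm c 2)) (*-assoc 2 c _)) ⟩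
    2 * (c * 3 ^ (2 + J))          ≤⟨ *-monoʳ-≤ 2 (<⇒≤ (count-multiples (3 ^ (2 + J)) n hit (2 * 3 ^ (1 + J)) 0 sound (≤-trans (m^n>0 3 (1 + J)) (m≤m+n _ _)))) ⟩
    2 * (n + 2 * 3 ^ (1 + J))      ∎
  eq : ∀ n k P → 12 * n + 2 * k + 3 * P + 2 * (n + 2 * P) + 2 * P ≡ 12 * n + 2 * (n + k) + 3 * (3 * P)
  eq = solve-∀

-- From the number of levels to the logarithmic bound

n<3^n : ∀ n → n < 3 ^ n
n<3^n zero    = s≤s z≤n
n<3^n (suc n) = ≤-trans (s≤s (n<3^n n)) (≤-trans (+-monoˡ-≤ (3 ^ n) (m^n>0 3 n)) (+-monoʳ-≤ (3 ^ n) (m≤m+n (3 ^ n) _)))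

-- The search descends from `k` to the integer part `J` of the logarithm. The upper bound is relaxed
-- by a factor of three to the form that `host-universal` takes.
log₃ : ∀ {n} k → 1 ≤ n → n < 3 ^ k → ∃ λ J → 3 ^ J ≤ n × n < 3 ^ (2 + J)
log₃ zero    1≤n n< = ⊥-elim (<⇒≱ n< 1≤n)
log₃ {n} (suc k) 1≤n n< with n <? 3 ^ k
... | yes n<′ = log₃ k 1≤n n<′
... | no  n≮  = k , ≮⇒≥ n≮ , <-≤-trans n< (^-monoʳ-≤ 3 (n≤1+n (suc k)))

edges-bound : ∀ n J → 3 ^ J ≤ n → edges (host n J) ≤ 42 * n + 4 * (J * n)
edges-bound n J 3^J≤n = begin
  edges (host n J)                              ≤⟨ edges-host n J ⟩
  2 * Σ< n (reach J)                            ≤⟨ *-monoʳ-≤ 2 (reach-sum n J) ⟩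
  -- The error `3 ^ (2 + J)` is at most `9 * n`, whence the constant `2 * (12 + 9) = 42`.
  2 * (12 * n + 2 * (J * n) + 3 ^ (2 + J))      ≤⟨ *-monoʳ-≤ 2 (+-monoʳ-≤ (12 * n + 2 * (J * n)) (*-monoʳ-≤ 3 (*-monoʳ-≤ 3 3^J≤n))) ⟩
  2 * (12 * n + 2 * (J * n) + 3 * (3 * n))      ≡⟨ eq n (J * n) ⟩
  42 * n + 4 * (J * n)                          ∎
  where
  open ≤-Reasoning
  eq : ∀ n k → 2 * (12 * n + 2 * k + 3 * (3 * n)) ≡ 42 * n + 4 * k
  eq = solve-∀

-- The integer form of `4 / log₂ 3 ≤ 14 / 5`.
2^20≤3^14 : 2 ^ 20 ≤ 3 ^ 14
2^20≤3^14 = ≤ᵇ⇒≤ (2 ^ 20) (3 ^ 14) tt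

-- The bound `5 * e ≤ 14 * n * log₂ n + 5 * 42 * n` with both sides as exponents of two;
-- `J ≤ log₃ n` enters as `3 ^ J ≤ n`.
power-bound : ∀ n J e → 3 ^ J ≤ n → e ≤ 42 * n + 4 * (J * n) → 2 ^ (5 * e) ≤ n ^ (14 * n) * 2 ^ (5 * 42 * n)
power-bound n J e 3^J≤n e≤ = begin
  2 ^ (5 * e)                                ≤⟨ ^-monoʳ-≤ 2 (*-monoʳ-≤ 5 e≤) ⟩
  2 ^ (5 * (42 * n + 4 * (J * n)))           ≡⟨ cong (2 ^_) (eq n (J * n)) ⟩
  2 ^ (20 * (J * n) + 5 * 42 * n)            ≡⟨ ^-distribˡ-+-* 2 (20 * (J * n)) (5 * 42 * n) ⟩
  2 ^ (20 * (J * n)) * 2 ^ (5 * 42 * n)      ≤⟨ *-monoˡ-≤ (2 ^ (5 * 42 * n)) main ⟩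
  n ^ (14 * n) * 2 ^ (5 * 42 * n)            ∎
  where
  open ≤-Reasoning
  eq : ∀ n k → 5 * (42 * n + 4 * k) ≡ 20 * k + 5 * 42 * n
  eq = solve-∀
  exponents : ∀ J n → 14 * (J * n) ≡ J * (14 * n)
  exponents = solve-∀
  main : 2 ^ (20 * (J * n)) ≤ n ^ (14 * n)
  main = begin
    2 ^ (20 * (J * n))      ≡⟨ sym (^-*-assoc 2 20 (J * n)) ⟩
    (2 ^ 20) ^ (J * n)      ≤⟨ ^-monoˡ-≤ (J * n) 2^20≤3^14 ⟩
    (3 ^ 14) ^ (J * n)      ≡⟨ ^-*-assoc 3 14 (J * n) ⟩
    3 ^ (14 * (J * n))      ≡⟨ cong (3 ^_) (exponents J n) ⟩
    3 ^ (J * (14 * n))      ≡⟨ sym (^-*-assoc 3 J (14 * n)) ⟩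
    (3 ^ J) ^ (14 * n)      ≤⟨ ^-monoˡ-≤ (14 * n) 3^J≤n ⟩
    n ^ (14 * n)            ∎

theorem1p1 : Σ ℕ λ C → Σ ℕ λ N → ∀ (n : ℕ) → N ≤ n → 1 ≤ n →
    Σ (Graph n) λ G → Universal G × (2 ^ (5 * edges G) ≤ n ^ (14 * n) * 2 ^ (5 * C * n))
theorem1p1 = 42 , 0 , main
  where
  main : ∀ n → 0 ≤ n → 1 ≤ n →
    Σ (Graph n) λ G → Universal G × (2 ^ (5 * edges G) ≤ n ^ (14 * n) * 2 ^ (5 * 42 * n))
  main n _ 1≤n with log₃ n 1≤n (n<3^n n)
  ... | J , 3^J≤n , n<3^ = host n J , host-universal {J = J} n<3^ , power-bound n J (edges (host n J)) 3^J≤n (edges-bound n J 3^J≤n)
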